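{- Consider the Normal Partizan Domination game on a star $K_{1,n}$ with $n\geq 1$, whose universal (center) vertex has color $C$, with $a$ leaves of color $A$ and $b=n-a$ leaves of color $B$. If $a=b$, the value is $*2$. If $|a-b|=1$, the value is $*$. If $a\geq b+2$, the value is $\uparrow^{[a-b-1]}*$. If $b\geq a+2$, the value is $\downarrow_{[b-a-1]}*$.
   Context: Normal Partizan Domination game: a finite graph $G$ has each vertex colored $A$, $B$ or $C$. Alice and Bob alternately select a vertex; Alice may only select vertices colored $A$ or $C$, Bob only vertices colored $B$ or $C$. A vertex $u$ dominates $v$ if $u=v$ or $uv$ is an edge. A vertex may be selected only if it is playable, i.e. it dominates at least one vertex not dominated by the previously selected vertices; the game ends when the selected vertices form a dominating set. Under normal play the player unable to move loses. The game is regarded as a partizan combinatorial game with Alice as Left and Bob as Right, and its value is its value in Conway's combinatorial game theory ($\{X\mid Y\}$ has Left options $X$ and Right options $Y$; $G=H$ iff $G+(-H)$ is a second-player win). Notation: $*=\{0\mid 0\}$, $*2=\{0,*\mid 0,*\}$, $\uparrow=\{0\mid *\}$, $\downarrow=\{*\mid 0\}$; $\uparrow^{[1]}=\uparrow$, $\uparrow^{[m]}=\{\uparrow^{[m-1]}\mid *\}$ for $m\geq 2$; $\downarrow_{[1]}=\downarrow$, $\downarrow_{[m]}=\{*\mid \downarrow_{[m-1]}\}$ for $m\geq 2$; $J*$ denotes $J+*$. -}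

module Defs where

open import Data.Nat.Base using (ℕ; zero; suc)
open import Data.Fin.Base using (Fin; zero; suc)
open import Data.Fin.Subset using (Subset; _∈_; _∉_; _∪_; _⊃_; ⁅_⁆) renaming (⊥ to ∅)
open import Data.Fin.Subset.Properties using (x∈⁅x⁆; p⊆p∪q; q⊆p∪q)
open import Data.Fin.Subset.Induction using (⊃-wellFounded; Acc; acc)
open import Data.List.Base using (List; []; _∷_; [_]; length; lookup)
open import Data.Product.Base using (Σ-syntax; ∃-syntax; _×_; _,_)
open import Data.Sum.Base using (_⊎_; [_,_]′)
open import Data.Vec.Base using (Vec; count)
open import Relation.Binary.Definitions
  using (Symmetric; Irreflexive; Decidable; DecidableEquality)
open import Relation.Binary.PropositionalEquality.Core using (_≡_; refl)
open import Relation.Nullary using (¬_; yes; no)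

-- L and R index the Left and the Right options.
data Game : Set₁ where
  mk : {L R : Set} → (L → Game) → (R → Game) → Game

infix 5 ⟨_∣_⟩
⟨_∣_⟩ : List Game → List Game → Game
⟨ ls ∣ rs ⟩ = mk (lookup ls) (lookup rs)

infix 8 ⊖_
⊖_ : Game → Game
⊖ mk gl gr = mk (λ j → ⊖ gr j) (λ i → ⊖ gl i)

infixl 6 _⊕_
_⊕_ : Game → Game → Game
G@(mk gl gr) ⊕ H@(mk hl hr) =
  mk [ (λ i → gl i ⊕ H) , (λ i → G ⊕ hl i) ]′
     [ (λ j → gr j ⊕ H) , (λ j → G ⊕ hr j) ]′

-- Normal play: a player who has to move and has no option loses.
-- "First" and "Second" say whether the named player starts.
LeftWinsFirst LeftWinsSecond : Game → Set
LeftWinsFirst  (mk gl gr) = ∃[ i ] LeftWinsSecond (gl i)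
LeftWinsSecond (mk gl gr) = ∀ j → LeftWinsFirst (gr j)

RightWinsFirst RightWinsSecond : Game → Set
RightWinsFirst  (mk gl gr) = ∃[ j ] RightWinsSecond (gr j)
RightWinsSecond (mk gl gr) = ∀ i → RightWinsFirst (gl i)

SecondPlayerWins : Game → Set
SecondPlayerWins G = LeftWinsSecond G × RightWinsSecond G

infix 4 _≈_
_≈_ : Game → Game → Set
G ≈ H = SecondPlayerWins (G ⊕ ⊖ H)

𝟎 * *2 ↑ ↓ : Game
𝟎  = ⟨ [] ∣ [] ⟩
*  = ⟨ [ 𝟎 ] ∣ [ 𝟎 ] ⟩
*2 = ⟨ 𝟎 ∷ * ∷ [] ∣ 𝟎 ∷ * ∷ [] ⟩
↑  = ⟨ [ 𝟎 ] ∣ [ * ] ⟩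
↓  = ⟨ [ * ] ∣ [ 𝟎 ] ⟩

-- The standard notations ↑^[m] and ↓_[m] start at m = 1; the value at zero
-- only makes the functions total.
↑^[_] ↓₍_₎ : ℕ → Game
↑^[ zero ]        = 𝟎
↑^[ suc zero ]    = ↑
↑^[ suc (suc m) ] = ⟨ [ ↑^[ suc m ] ] ∣ [ * ] ⟩

↓₍ zero ₎        = 𝟎
↓₍ suc zero ₎    = ↓
↓₍ suc (suc m) ₎ = ⟨ [ * ] ∣ [ ↓₍ suc m ₎ ] ⟩

record Graph (n : ℕ) : Set₁ where
  field
    Adj    : Fin n → Fin n → Set
    adj?   : Decidable Adj
    sym    : Symmetric Adj
    irrefl : Irreflexive _≡_ Adj

data Colour : Set where
  A B C : Colour

_≟_ : DecidableEquality Colour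
A ≟ A = yes refl
A ≟ B = no λ ()
A ≟ C = no λ ()
B ≟ A = no λ ()
B ≟ B = yes refl
B ≟ C = no λ ()
C ≟ A = no λ ()
C ≟ B = no λ ()
C ≟ C = yes refl

#[_] : ∀ {n} → Colour → Vec Colour n → ℕ
#[ c ] = count (c ≟_)

data Player : Set where
  Alice Bob : Player

data MaySelect : Player → Colour → Set where
  alice-A : MaySelect Alice A
  alice-C : MaySelect Alice C
  bob-B   : MaySelect Bob B
  bob-C   : MaySelect Bob C

module _ {n : ℕ} (G : Graph n) where
  open Graph G

  Dominates : Fin n → Fin n → Set
  Dominates u v = u ≡ v ⊎ Adj u v

  DominatedBy : Subset n → Fin n → Set
  DominatedBy S v = ∃[ s ] (s ∈ S × Dominates s v)

  Playable : Subset n → Fin n → Set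
  Playable S u = ∃[ v ] (Dominates u v × ¬ DominatedBy S v)

  playable⇒⊃ : ∀ {S u} → Playable S u → (S ∪ ⁅ u ⁆) ⊃ S
  playable⇒⊃ {S} {u} (v , u≻v , undominated) =
      p⊆p∪q ⁅ u ⁆
    , u , q⊆p∪q S ⁅ u ⁆ (x∈⁅x⁆ u) , λ u∈S → undominated (u , u∈S , u≻v)

  module _ (colour : Fin n → Colour) where

    -- Alice is Left and Bob is Right.
    Move : Player → Subset n → Set
    Move p S = Σ[ u ∈ Fin n ] (MaySelect p (colour u) × Playable S u)

    -- S is the set of vertices selected so far. When S is a dominating
    -- set no vertex is playable, so the end of the game needs no clause.
    position : (S : Subset n) → Acc _⊃_ S → Game
    position S (acc rs) = mk {Move Alice S} {Move Bob S}
      (λ (u , _ , playable) → position (S ∪ ⁅ u ⁆) (rs (playable⇒⊃ playable)))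
      (λ (u , _ , playable) → position (S ∪ ⁅ u ⁆) (rs (playable⇒⊃ playable)))

    dominationGame : Game
    dominationGame = position ∅ (⊃-wellFounded ∅)

-- The centre of K₁,ₙ is zero, its leaves are suc i.
data StarAdj {n : ℕ} : Fin (suc n) → Fin (suc n) → Set where
  centre-leaf : ∀ i → StarAdj zero (suc i)
  leaf-centre : ∀ i → StarAdj (suc i) zero

star : (n : ℕ) → Graph (suc n)
star n = record
  { Adj    = StarAdj
  ; adj?   = λ where
      zero    zero    → no λ ()
      zero    (suc i) → yes (centre-leaf i)
      (suc i) zero    → yes (leaf-centre i)
      (suc i) (suc j) → no λ ()
  ; sym    = λ where
      (centre-leaf i) → leaf-centre i
      (leaf-centre i) → centre-leaf i
  ; irrefl = λ where
      refl ()
  }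

{-# OPTIONS --safe #-}
module Submission where

-- Once the centre is selected the game is over, and a selected leaf only
-- removes itself, so a position is determined by the numbers a and b of
-- undominated leaves of the two colours. For a = b + 1 + m the second player
-- wins the difference with ↑^[m]* by answering in kind: a leaf is answered by a
-- leaf of the other colour or by a step ↑^[m] → ↑^[m-1], and a step ↑^[m] → *
-- by the centre. The case m = 0 is the value *, the cases a < b follow by
-- negation, and for a = b each answer leads to a comparison with *.

open import Defs
open import Data.Nat.Base using (ℕ; zero; suc; _+_; _∸_; _≥_; _<_; ∣_-_∣; s≤s)
open import Data.Vec.Base using (Vec; []; _∷_; here; there; lookup)
open import Data.Product.Base using (∃-syntax; _×_; _,_; proj₁; proj₂)
open import Relation.Binary.PropositionalEquality.Core
  using (_≡_; _≢_; refl; sym; trans; cong; subst)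

open import Data.Bool.Base using (true; false)
open import Data.Empty using (⊥-elim)
open import Data.Fin.Base using (Fin; zero; suc)
open import Data.Fin.Subset using (Subset; inside; outside; _∉_; _∪_; _⊃_; ⁅_⁆) renaming (⊥ to ∅)
open import Data.Fin.Subset.Induction using (Acc; acc; ⊃-wellFounded)
open import Data.Fin.Subset.Properties using (∪-identityʳ; ∉⊥; drop-there)
import Data.List.Base as List
open import Data.Nat.Properties using (suc-injective; +-suc; +-identityʳ; +-cancelˡ-≡; n≮0; 0<1+n; 0≢1+n)
open import Data.Sum.Base using (_⊎_; inj₁; inj₂; [_,_]; swap)
open import Relation.Nullary using (¬_; yes; no)

-- Isomorphism of game trees and outcomes.

infix 4 _≅_
-- Options are matched in both directions but not bijectively, so the moves at all leaves of one
-- colour can correspond to a single `leaf` move. Outcomes respect this relation, so rewriting along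
-- it stands in for transitivity of `≈`.
data _≅_ : Game → Game → Set₁ where
  mk : ∀ {L R L′ R′ : Set} {gl : L → Game} {gr : R → Game} {hl : L′ → Game} {hr : R′ → Game} →
       (∀ i → ∃[ k ] gl i ≅ hl k) → (∀ k → ∃[ i ] gl i ≅ hl k) →
       (∀ j → ∃[ k ] gr j ≅ hr k) → (∀ k → ∃[ j ] gr j ≅ hr k) →
       mk gl gr ≅ mk hl hr

≅-refl : ∀ {G} → G ≅ G
≅-refl {mk gl gr} =
  mk (λ i → i , ≅-refl) (λ i → i , ≅-refl) (λ j → j , ≅-refl) (λ j → j , ≅-refl)

≅-sym : ∀ {G H} → G ≅ H → H ≅ G
≅-sym {mk _ _} {mk _ _} (mk l l′ r r′) =
  mk (λ k → let i , e = l′ k in i , ≅-sym e) (λ i → let k , e = l i in k , ≅-sym e)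
     (λ k → let j , e = r′ k in j , ≅-sym e) (λ j → let k , e = r j in k , ≅-sym e)

≅-trans : ∀ {G H K} → G ≅ H → H ≅ K → G ≅ K
≅-trans {mk _ _} {mk _ _} {mk _ _} (mk l l′ r r′) (mk m m′ s s′) =
  mk (λ i → let j , e = l i  ; k , f = m j  in k , ≅-trans e f)
     (λ k → let j , f = m′ k ; i , e = l′ j in i , ≅-trans e f)
     (λ i → let j , e = r i  ; k , f = s j  in k , ≅-trans e f)
     (λ k → let j , f = s′ k ; i , e = r′ j in i , ≅-trans e f)

⊖-cong : ∀ {G H} → G ≅ H → ⊖ G ≅ ⊖ H
⊖-cong {mk _ _} {mk _ _} (mk l l′ r r′) =
  mk (λ j → let k , e = r j in k , ⊖-cong e) (λ k → let j , e = r′ k in j , ⊖-cong e)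
     (λ i → let k , e = l i in k , ⊖-cong e) (λ k → let i , e = l′ k in i , ⊖-cong e)

⊕-cong : ∀ {G G′ H H′} → G ≅ G′ → H ≅ H′ → G ⊕ H ≅ G′ ⊕ H′
⊕-cong {G@(mk _ _)} {G′@(mk _ _)} {H@(mk _ _)} {H′@(mk _ _)} p@(mk l l′ r r′) q@(mk m m′ s s′) = mk
  [ (λ i → let k , e = l  i in inj₁ k , ⊕-cong e q) , (λ i → let k , e = m  i in inj₂ k , ⊕-cong p e) ]
  [ (λ k → let i , e = l′ k in inj₁ i , ⊕-cong e q) , (λ k → let i , e = m′ k in inj₂ i , ⊕-cong p e) ]
  [ (λ j → let k , e = r  j in inj₁ k , ⊕-cong e q) , (λ j → let k , e = s  j in inj₂ k , ⊕-cong p e) ]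
  [ (λ k → let j , e = r′ k in inj₁ j , ⊕-cong e q) , (λ k → let j , e = s′ k in inj₂ j , ⊕-cong p e) ]

⊖-⊕ : ∀ G H → ⊖ (G ⊕ H) ≅ ⊖ G ⊕ ⊖ H
⊖-⊕ G@(mk gl gr) H@(mk hl hr) = mk
  [ (λ j → inj₁ j , ⊖-⊕ (gr j) H) , (λ j → inj₂ j , ⊖-⊕ G (hr j)) ]
  [ (λ j → inj₁ j , ⊖-⊕ (gr j) H) , (λ j → inj₂ j , ⊖-⊕ G (hr j)) ]
  [ (λ i → inj₁ i , ⊖-⊕ (gl i) H) , (λ i → inj₂ i , ⊖-⊕ G (hl i)) ]
  [ (λ i → inj₁ i , ⊖-⊕ (gl i) H) , (λ i → inj₂ i , ⊖-⊕ G (hl i)) ]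

⊕-identityˡ : ∀ G → 𝟎 ⊕ G ≅ G
⊕-identityˡ (mk gl gr) = mk
  (λ { (inj₁ ()) ; (inj₂ i) → i , ⊕-identityˡ (gl i) }) (λ i → inj₂ i , ⊕-identityˡ (gl i))
  (λ { (inj₁ ()) ; (inj₂ j) → j , ⊕-identityˡ (gr j) }) (λ j → inj₂ j , ⊕-identityˡ (gr j))

mutual
  leftFirst-resp : ∀ {G H} → G ≅ H → LeftWinsFirst G → LeftWinsFirst H
  leftFirst-resp {mk _ _} {mk _ _} (mk l _ _ _) (i , w) =
    let k , e = l i in k , leftSecond-resp e w

  leftSecond-resp : ∀ {G H} → G ≅ H → LeftWinsSecond G → LeftWinsSecond H
  leftSecond-resp {mk _ _} {mk _ _} (mk _ _ _ r′) w k =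
    let j , e = r′ k in leftFirst-resp e (w j)

mutual
  rightFirst-resp : ∀ {G H} → G ≅ H → RightWinsFirst G → RightWinsFirst H
  rightFirst-resp {mk _ _} {mk _ _} (mk _ _ r _) (j , w) =
    let k , e = r j in k , rightSecond-resp e w

  rightSecond-resp : ∀ {G H} → G ≅ H → RightWinsSecond G → RightWinsSecond H
  rightSecond-resp {mk _ _} {mk _ _} (mk _ l′ _ _) w k =
    let i , e = l′ k in rightFirst-resp e (w i)

mutual
  ⊖-leftFirst : ∀ {G} → RightWinsFirst G → LeftWinsFirst (⊖ G)
  ⊖-leftFirst {mk _ _} (j , w) = j , ⊖-leftSecond w

  ⊖-leftSecond : ∀ {G} → RightWinsSecond G → LeftWinsSecond (⊖ G)
  ⊖-leftSecond {mk _ _} w i = ⊖-leftFirst (w i)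

mutual
  ⊖-rightFirst : ∀ {G} → LeftWinsFirst G → RightWinsFirst (⊖ G)
  ⊖-rightFirst {mk _ _} (i , w) = i , ⊖-rightSecond w

  ⊖-rightSecond : ∀ {G} → LeftWinsSecond G → RightWinsSecond (⊖ G)
  ⊖-rightSecond {mk _ _} w j = ⊖-rightFirst (w j)

≈-resp-≅ : ∀ {G G′ H H′} → G ≅ G′ → H ≅ H′ → G ≈ H → G′ ≈ H′
≈-resp-≅ p q (l , r) = leftSecond-resp e l , rightSecond-resp e r
  where e = ⊕-cong p (⊖-cong q)

-- Negation exchanges the players, so each player's strategy is the other's old one. This carries
-- results for a majority of `A` over to a majority of `B`.
⊖-≈ : ∀ {G H} → G ≈ H → ⊖ G ≈ ⊖ H
⊖-≈ {G} {H} (l , r) =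
  leftSecond-resp e (⊖-leftSecond r) , rightSecond-resp e (⊖-rightSecond l)
  where e = ⊖-⊕ G (⊖ H)

-- Negatives of the named values.

⊖𝟎≅𝟎 : ⊖ 𝟎 ≅ 𝟎
⊖𝟎≅𝟎 = mk (λ ()) (λ ()) (λ ()) (λ ())

⟨∣⟩-cong : ∀ {G G′ H H′} → G ≅ G′ → H ≅ H′ → ⟨ List.[ G ] ∣ List.[ H ] ⟩ ≅ ⟨ List.[ G′ ] ∣ List.[ H′ ] ⟩
⟨∣⟩-cong p q = mk (λ { zero → zero , p }) (λ { zero → zero , p })
                  (λ { zero → zero , q }) (λ { zero → zero , q })

⊖-⟨∣⟩ : ∀ {G H} → ⊖ ⟨ List.[ G ] ∣ List.[ H ] ⟩ ≅ ⟨ List.[ ⊖ H ] ∣ List.[ ⊖ G ] ⟩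
⊖-⟨∣⟩ = mk (λ { zero → zero , ≅-refl }) (λ { zero → zero , ≅-refl })
            (λ { zero → zero , ≅-refl }) (λ { zero → zero , ≅-refl })

⊖*≅* : ⊖ * ≅ *
⊖*≅* = ≅-trans ⊖-⟨∣⟩ (⟨∣⟩-cong ⊖𝟎≅𝟎 ⊖𝟎≅𝟎)

⊖↑≅↓ : ∀ m → ⊖ ↑^[ m ] ≅ ↓₍ m ₎
⊖↑≅↓ zero          = ⊖𝟎≅𝟎
⊖↑≅↓ (suc zero)    = ≅-trans ⊖-⟨∣⟩ (⟨∣⟩-cong ⊖*≅* ⊖𝟎≅𝟎)
⊖↑≅↓ (suc (suc m)) = ≅-trans ⊖-⟨∣⟩ (⟨∣⟩-cong ⊖*≅* (⊖↑≅↓ (suc m)))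

⊖↑*≅↓* : ∀ m → ⊖ (↑^[ m ] ⊕ *) ≅ ↓₍ m ₎ ⊕ *
⊖↑*≅↓* m = ≅-trans (⊖-⊕ ↑^[ m ] *) (⊕-cong (⊖↑≅↓ m) ⊖*≅*)

-- The star game on leaf counts.

-- Moves of a player with x undominated leaves when the opponent has y.
data StarMove : ℕ → ℕ → Set where
  centre : ∀ {x y} → 0 < x ⊎ 0 < y → StarMove x y
  leaf   : ∀ {x y} → StarMove (suc x) y

mutual
  -- Models the positions whose centre is unselected. When both counts are zero all leaves are
  -- selected and, in a star with at least one leaf, the centre is dominated too; hence the guard on
  -- `centre`.
  starGame : ℕ → ℕ → Game
  starGame a b = mk (leftOption a b) (rightOption a b)

  leftOption : ∀ a b → StarMove a b → Game
  leftOption a       b (centre _) = 𝟎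
  leftOption (suc a) b leaf       = starGame a b

  rightOption : ∀ a b → StarMove b a → Game
  rightOption a b       (centre _) = 𝟎
  rightOption a (suc b) leaf       = starGame a b

mutual
  ⊖-starGame : ∀ a b → ⊖ starGame a b ≅ starGame b a
  ⊖-starGame a b =
    mk (λ m → m , ⊖-rightOption a b m) (λ m → m , ⊖-rightOption a b m)
       (λ m → m , ⊖-leftOption a b m) (λ m → m , ⊖-leftOption a b m)

  ⊖-leftOption : ∀ a b m → ⊖ leftOption a b m ≅ rightOption b a m
  ⊖-leftOption a       b (centre _) = ⊖𝟎≅𝟎
  ⊖-leftOption (suc a) b leaf       = ⊖-starGame a b

  ⊖-rightOption : ∀ a b m → ⊖ rightOption a b m ≅ leftOption b a m
  ⊖-rightOption a b       (centre _) = ⊖𝟎≅𝟎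
  ⊖-rightOption a (suc b) leaf       = ⊖-starGame a b

data UpMove : ℕ → Set where
  move : ∀ {m} → UpMove (suc m)

-- Unlike ↑^[ m ], this is a constructor application for every m, so that the
-- options of a sum containing it compute.
ups : ℕ → Game
ups m = mk {UpMove m} {UpMove m} (pred m) (λ _ → *)
  where
  pred : ∀ m → UpMove m → Game
  pred (suc m) move = ups m

ups-suc : ∀ m → ups (suc m) ≅ ⟨ List.[ ups m ] ∣ List.[ * ] ⟩
ups-suc m = mk (λ { move → zero , ≅-refl }) (λ { zero → move , ≅-refl })
               (λ { move → zero , ≅-refl }) (λ { zero → move , ≅-refl })

ups≅↑ : ∀ m → ups m ≅ ↑^[ m ]
ups≅↑ zero          = mk (λ ()) (λ ()) (λ ()) (λ ())
ups≅↑ (suc zero)    = ≅-trans (ups-suc 0) (⟨∣⟩-cong (ups≅↑ 0) ≅-refl)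
ups≅↑ (suc (suc m)) = ≅-trans (ups-suc (suc m)) (⟨∣⟩-cong (ups≅↑ (suc m)) ≅-refl)

-- Comparison of star games with their values.

𝟎≥𝟎 : LeftWinsSecond (𝟎 ⊕ ⊖ (𝟎 ⊕ 𝟎))
𝟎≥𝟎 (inj₂ (inj₁ ()))
𝟎≥𝟎 (inj₂ (inj₂ ()))

𝟎≤𝟎 : RightWinsSecond (𝟎 ⊕ ⊖ (𝟎 ⊕ 𝟎))
𝟎≤𝟎 (inj₂ (inj₁ ()))
𝟎≤𝟎 (inj₂ (inj₂ ()))

𝟎≈*+* : 𝟎 ≈ * ⊕ *
𝟎≈*+* = (λ { (inj₂ (inj₁ zero)) → inj₂ (inj₂ zero) , 𝟎≥𝟎
           ; (inj₂ (inj₂ zero)) → inj₂ (inj₁ zero) , 𝟎≥𝟎 })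
      , (λ { (inj₂ (inj₁ zero)) → inj₂ (inj₂ zero) , 𝟎≤𝟎
           ; (inj₂ (inj₂ zero)) → inj₂ (inj₁ zero) , 𝟎≤𝟎 })

-- Left can only turn the negated `ups` into `*`, which Right then removes. The converse inequality
-- holds for `m = 0` alone.
𝟎≤ups : ∀ m → RightWinsSecond (𝟎 ⊕ ⊖ (ups m ⊕ 𝟎))
𝟎≤ups (suc m) (inj₂ (inj₁ move)) = inj₂ (inj₁ zero) , 𝟎≤𝟎

𝟎≥ups0 : LeftWinsSecond (𝟎 ⊕ ⊖ (ups 0 ⊕ 𝟎))
𝟎≥ups0 (inj₂ (inj₁ ()))
𝟎≥ups0 (inj₂ (inj₂ ()))

-- Covers the position reached when Right removes the summand `*` of `ups (suc m) ⊕ *` and Left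
-- answers by turning `ups (suc m)` into `*`.
starGame≥* : ∀ {a b} m → a ≡ suc (m + b) → LeftWinsSecond (starGame a b ⊕ ⊖ (* ⊕ 𝟎))
starGame≥* m refl (inj₁ (centre _)) = inj₂ (inj₁ zero) , 𝟎≥𝟎
starGame≥* m refl (inj₁ (leaf {b})) = inj₁ leaf , starGame≥* m (+-suc m b)
starGame≥* m refl (inj₂ (inj₁ zero)) = inj₁ (centre (inj₁ 0<1+n)) , 𝟎≥𝟎

starGame≥↑* : ∀ m {a b} → a ≡ suc (m + b) → LeftWinsSecond (starGame a b ⊕ ⊖ (ups m ⊕ *))
starGame≥↑* zero    refl (inj₁ (centre _)) = inj₂ (inj₂ zero) , 𝟎≥ups0
-- Removing `*` would leave the negative of a positive game, so Left creates a second `*` and relies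
-- on `* ⊕ *` being zero.
starGame≥↑* (suc m) refl (inj₁ (centre _)) = inj₂ (inj₁ move) , proj₁ 𝟎≈*+*
-- After both leaves are gone the counts are `m + suc b` and `b`, so the surplus is `suc m` again.
starGame≥↑* m refl (inj₁ (leaf {b})) = inj₁ leaf , starGame≥↑* m (+-suc m b)
starGame≥↑* (suc m) refl (inj₂ (inj₁ move)) = inj₁ leaf , starGame≥↑* m refl
starGame≥↑* zero    refl (inj₂ (inj₂ zero)) = inj₁ (centre (inj₁ 0<1+n)) , 𝟎≥ups0
starGame≥↑* (suc m) refl (inj₂ (inj₂ zero)) = inj₂ (inj₁ move) , starGame≥* (suc m) refl

starGame≤↑* : ∀ m {a b} → a ≡ suc (m + b) → RightWinsSecond (starGame a b ⊕ ⊖ (ups m ⊕ *))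
starGame≤↑* m refl (inj₁ (centre _)) = inj₂ (inj₂ zero) , 𝟎≤ups m
-- Left has taken the only leaf and Right has none to answer with, so Right removes `*`, after which
-- no component has a move.
starGame≤↑* zero {b = zero} refl (inj₁ leaf) = inj₂ (inj₂ zero) , stuck
  where
  stuck : RightWinsSecond (starGame 0 0 ⊕ ⊖ (ups 0 ⊕ 𝟎))
  stuck (inj₁ (centre (inj₁ ())))
  stuck (inj₁ (centre (inj₂ ())))
  stuck (inj₂ (inj₁ ()))
  stuck (inj₂ (inj₂ ()))
starGame≤↑* zero {b = suc b} refl (inj₁ leaf) = inj₁ leaf , starGame≤↑* zero refl
starGame≤↑* (suc m) refl (inj₁ leaf) = inj₂ (inj₁ move) , starGame≤↑* m refl
starGame≤↑* (suc m) refl (inj₂ (inj₁ move)) = inj₁ (centre (inj₂ 0<1+n)) , proj₂ 𝟎≈*+*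
starGame≤↑* m refl (inj₂ (inj₂ zero)) = inj₁ (centre (inj₂ 0<1+n)) , 𝟎≤ups m

starGame≈↑* : ∀ m {a b} → a ≡ suc (m + b) → starGame a b ≈ ↑^[ m ] ⊕ *
starGame≈↑* m e =
  ≈-resp-≅ ≅-refl (⊕-cong (ups≅↑ m) ≅-refl) (starGame≥↑* m e , starGame≤↑* m e)

starGame≈↓* : ∀ m {a b} → b ≡ suc (m + a) → starGame a b ≈ ↓₍ m ₎ ⊕ *
starGame≈↓* m {a} {b} e = ≈-resp-≅ (⊖-starGame b a) (⊖↑*≅↓* m) (⊖-≈ (starGame≈↑* m e))

starGame≈*ˡ : ∀ b → starGame (suc b) b ≈ *
starGame≈*ˡ b = ≈-resp-≅ ≅-refl (⊕-identityˡ *) (starGame≈↑* 0 refl)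

starGame≈*ʳ : ∀ a → starGame a (suc a) ≈ *
starGame≈*ʳ a = ≈-resp-≅ ≅-refl (⊕-identityˡ *) (starGame≈↓* 0 refl)

-- Options correspond: `centre` to `𝟎` and a leaf to `*`, since taking a leaf from a balanced star
-- leaves the opponent a surplus of one.
starGame≈*2 : ∀ a → starGame (suc a) (suc a) ≈ *2
starGame≈*2 a =
  (λ { (inj₁ (centre _))  → inj₂ zero , 𝟎≥⊖𝟎
     ; (inj₁ leaf)        → inj₂ (suc zero) , proj₁ (starGame≈*ˡ a)
     ; (inj₂ zero)        → inj₁ (centre (inj₁ 0<1+n)) , 𝟎≥⊖𝟎
     ; (inj₂ (suc zero))  → inj₁ leaf , proj₁ (starGame≈*ʳ a) }) ,
  (λ { (inj₁ (centre _))  → inj₂ zero , 𝟎≤⊖𝟎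
     ; (inj₁ leaf)        → inj₂ (suc zero) , proj₂ (starGame≈*ʳ a)
     ; (inj₂ zero)        → inj₁ (centre (inj₁ 0<1+n)) , 𝟎≤⊖𝟎
     ; (inj₂ (suc zero))  → inj₁ leaf , proj₂ (starGame≈*ˡ a) })
  where
  𝟎≥⊖𝟎 : LeftWinsSecond (𝟎 ⊕ ⊖ 𝟎)
  𝟎≥⊖𝟎 (inj₁ ())
  𝟎≥⊖𝟎 (inj₂ ())
  𝟎≤⊖𝟎 : RightWinsSecond (𝟎 ⊕ ⊖ 𝟎)
  𝟎≤⊖𝟎 (inj₁ ())
  𝟎≤⊖𝟎 (inj₂ ())

-- Counting unselected leaves by colour.

-- The subset holds selected leaves only, without the centre. While the centre is unselected, a leaf
-- is undominated exactly when it is unselected.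
remaining : ∀ {n} → Colour → Vec Colour n → Subset n → ℕ
remaining c []       []            = 0
remaining c (x ∷ xs) (true  ∷ S)   = remaining c xs S
remaining c (x ∷ xs) (false ∷ S)   with c ≟ x
... | yes _ = suc (remaining c xs S)
... | no  _ = remaining c xs S

remaining-∅ : ∀ {n} c (xs : Vec Colour n) → remaining c xs ∅ ≡ #[ c ] xs
remaining-∅ c []       = refl
remaining-∅ c (x ∷ xs) with c ≟ x
... | yes _ = cong suc (remaining-∅ c xs)
... | no  _ = remaining-∅ c xs

remaining-select : ∀ {n} (xs : Vec Colour n) {S i} → i ∉ S →
  remaining (lookup xs i) xs S ≡ suc (remaining (lookup xs i) xs (S ∪ ⁅ i ⁆))
remaining-select (x ∷ xs) {true  ∷ S} {zero} i∉S = ⊥-elim (i∉S here)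
remaining-select (x ∷ xs) {false ∷ S} {zero} i∉S with x ≟ x
-- The tail of `⁅ zero ⁆` is empty, so the union has tail `S ∪ ∅`.
... | yes _   = cong (λ T → suc (remaining x xs T)) (sym (∪-identityʳ S))
... | no  x≢x = ⊥-elim (x≢x refl)
remaining-select (x ∷ xs) {true  ∷ S} {suc i} i∉S = remaining-select xs (λ p → i∉S (there p))
remaining-select (x ∷ xs) {false ∷ S} {suc i} i∉S with lookup xs i ≟ x
... | yes _ = cong suc (remaining-select xs (λ p → i∉S (there p)))
... | no  _ = remaining-select xs (λ p → i∉S (there p))

remaining-select-≢ : ∀ {n} (xs : Vec Colour n) {S i c} → c ≢ lookup xs i →
  remaining c xs S ≡ remaining c xs (S ∪ ⁅ i ⁆)
remaining-select-≢ (x ∷ xs) {true  ∷ S} {zero} {c} c≢ = cong (remaining c xs) (sym (∪-identityʳ S))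
remaining-select-≢ (x ∷ xs) {false ∷ S} {zero} {c} c≢ with c ≟ x
... | yes c≡x = ⊥-elim (c≢ c≡x)
... | no  _   = cong (remaining c xs) (sym (∪-identityʳ S))
remaining-select-≢ (x ∷ xs) {true  ∷ S} {suc i} c≢ = remaining-select-≢ xs c≢
remaining-select-≢ (x ∷ xs) {false ∷ S} {suc i} {c} c≢ with c ≟ x
... | yes _ = cong suc (remaining-select-≢ xs c≢)
... | no  _ = remaining-select-≢ xs c≢

remaining-find : ∀ {n} c (xs : Vec Colour n) S → 0 < remaining c xs S →
  ∃[ i ] (i ∉ S × lookup xs i ≡ c)
remaining-find c []       []        ()
remaining-find c (x ∷ xs) (true ∷ S) p =
  let i , i∉S , e = remaining-find c xs S p in suc i , (λ q → i∉S (drop-there q)) , e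
remaining-find c (x ∷ xs) (false ∷ S) p with c ≟ x
... | yes c≡x = zero , (λ ()) , sym c≡x
... | no  _   =
  let i , i∉S , e = remaining-find c xs S p in suc i , (λ q → i∉S (drop-there q)) , e

#-total : ∀ {n} (xs : Vec Colour n) → #[ A ] xs + #[ B ] xs + #[ C ] xs ≡ n
#-total []       = refl
#-total (A ∷ xs) = cong suc (#-total xs)
#-total (B ∷ xs) = trans (cong (_+ #[ C ] xs) (+-suc (#[ A ] xs) (#[ B ] xs))) (cong suc (#-total xs))
#-total (C ∷ xs) = trans (+-suc _ _) (cong suc (#-total xs))

-- The three colour counts add up to `n`, so none is left for `C`; but selecting a leaf of colour
-- `C` from `∅` would make that count a successor.
uncoloured-C : ∀ {n} (xs : Vec Colour n) → #[ A ] xs + #[ B ] xs ≡ n → ∀ i → lookup xs i ≢ C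
uncoloured-C xs e i eq = 0≢1+n (trans (sym #C≡0) (trans (sym (remaining-∅ C xs))
  (subst (λ c → remaining c xs ∅ ≡ suc (remaining c xs (∅ ∪ ⁅ i ⁆))) eq (remaining-select xs ∉⊥))))
  where
  #C≡0 : #[ C ] xs ≡ 0
  #C≡0 = +-cancelˡ-≡ (#[ A ] xs + #[ B ] xs) _ _
    (trans (#-total xs) (trans (sym e) (sym (+-identityʳ _))))

-- Playability in the star.

module _ {n : ℕ} where

  -- Only the centre and the leaf itself dominate a leaf, and neither is selected.
  leaf-undominated : ∀ {S : Subset n} {i} → i ∉ S → ¬ DominatedBy (star n) (outside ∷ S) (suc i)
  leaf-undominated i∉S (zero  , ()  , _)
  leaf-undominated i∉S (suc _ , i∈S , inj₁ refl) = i∉S (drop-there i∈S)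
  leaf-undominated i∉S (suc _ , _   , inj₂ ())

  centre-playable : ∀ {S : Subset n} {i} → i ∉ S → Playable (star n) (outside ∷ S) zero
  centre-playable {i = i} i∉S = suc i , inj₂ (centre-leaf i) , leaf-undominated i∉S

  leaf-playable : ∀ {S : Subset n} {i} → i ∉ S → Playable (star n) (outside ∷ S) (suc i)
  leaf-playable {i = i} i∉S = suc i , inj₁ refl , leaf-undominated i∉S

  leaf-playable⁻¹ : ∀ {S : Subset n} {i} → Playable (star n) (outside ∷ S) (suc i) → i ∉ S
  leaf-playable⁻¹ (v , dom , undominated) i∈S = undominated (_ , there i∈S , dom)

  centre-dominates : ∀ (v : Fin (suc n)) → Dominates (star n) zero v
  centre-dominates zero    = inj₁ refl
  centre-dominates (suc i) = inj₂ (centre-leaf i)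

  unplayable : ∀ {S : Subset n} {u} → ¬ Playable (star n) (inside ∷ S) u
  unplayable (v , _ , undominated) = undominated (zero , here , centre-dominates v)

  centre-selected : ∀ {colour} (S : Subset n) (rs : Acc _⊃_ (inside ∷ S)) →
    position (star n) colour (inside ∷ S) rs ≅ 𝟎
  centre-selected S (acc rs) =
    mk (λ (_ , _ , playable) → ⊥-elim (unplayable playable)) (λ ())
       (λ (_ , _ , playable) → ⊥-elim (unplayable playable)) (λ ())

-- The newly dominated vertex is either an unselected leaf or the centre. In the latter case no leaf
-- is selected, and `0 < n` supplies a first leaf.
centre-playable⁻¹ : ∀ {n} {S : Subset n} → 0 < n → Playable (star n) (outside ∷ S) zero → ∃[ i ] i ∉ S
centre-playable⁻¹ (s≤s _) (zero  , _ , undominated) =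
  zero , λ 0∈S → undominated (suc zero , there 0∈S , inj₂ (leaf-centre zero))
centre-playable⁻¹ _ (suc i , _ , undominated) =
  i , λ i∈S → undominated (suc i , there i∈S , inj₁ refl)

-- Star positions as leaf counts.

module _ {n : ℕ} (n>0 : 0 < n) (leaves : Vec Colour n) (≢C : ∀ i → lookup leaves i ≢ C) where

  private
    rem : Colour → Subset n → ℕ
    rem c = remaining c leaves

    -- With `unfinished`, this makes the guard of `centre` equivalent to the existence of an
    -- unselected leaf, hence to playability of the centre.
    found : ∀ {S a b} → rem A S ≡ a → rem B S ≡ b → 0 < a ⊎ 0 < b → ∃[ i ] i ∉ S
    found {S} refl refl (inj₁ p) = let i , i∉S , _ = remaining-find A leaves S p in i , i∉S
    found {S} refl refl (inj₂ p) = let i , i∉S , _ = remaining-find B leaves S p in i , i∉S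

    unfinished : ∀ {S a b i} → rem A S ≡ a → rem B S ≡ b → i ∉ S → 0 < a ⊎ 0 < b
    unfinished {S} {i = i} refl refl i∉S with lookup leaves i in eq | remaining-select leaves {S} i∉S
    ... | A | e = inj₁ (subst (0 <_) (sym e) 0<1+n)
    ... | B | e = inj₂ (subst (0 <_) (sym e) 0<1+n)
    ... | C | _ = ⊥-elim (≢C i eq)

    select : ∀ {S i c} → i ∉ S → lookup leaves i ≡ c →
      rem c S ≡ suc (rem c (S ∪ ⁅ i ⁆)) × (∀ {d} → d ≢ c → rem d S ≡ rem d (S ∪ ⁅ i ⁆))
    select i∉S refl = remaining-select leaves i∉S , remaining-select-≢ leaves

    alice-leaf : ∀ {i} → MaySelect Alice (lookup leaves i) → lookup leaves i ≡ A
    alice-leaf {i} m with lookup leaves i in eq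
    alice-leaf {i} m | A = refl
    alice-leaf {i} m | C = ⊥-elim (≢C i eq)

    bob-leaf : ∀ {i} → MaySelect Bob (lookup leaves i) → lookup leaves i ≡ B
    bob-leaf {i} m with lookup leaves i in eq
    bob-leaf {i} m | B = refl
    bob-leaf {i} m | C = ⊥-elim (≢C i eq)

  -- Recursion on accessibility: the centre leads to `𝟎`, and a leaf lowers exactly the count of its
  -- own colour. The counts enter through equations so that the indices of `StarMove` are variables
  -- when its moves are matched.
  position≅starGame : ∀ S (rs : Acc _⊃_ (outside ∷ S)) {a b} → rem A S ≡ a → rem B S ≡ b →
    position (star n) (lookup (C ∷ leaves)) (outside ∷ S) rs ≅ starGame a b
  position≅starGame S (acc rs) ea eb = mk
    (alice ea eb) (alice⁻¹ ea eb) (bob ea eb) (bob⁻¹ ea eb)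
    where
    Moves : Player → Set
    Moves p = Move (star n) (lookup (C ∷ leaves)) p (outside ∷ S)

    after : ∀ {p} → Moves p → Game
    after (u , _ , playable) =
      position (star n) (lookup (C ∷ leaves)) ((outside ∷ S) ∪ ⁅ u ⁆) (rs (playable⇒⊃ (star n) playable))

    alice : ∀ {a b} → rem A S ≡ a → rem B S ≡ b → (m : Moves Alice) → ∃[ k ] after m ≅ leftOption a b k
    alice ea eb (zero , _ , playable) =
      centre (unfinished ea eb (proj₂ (centre-playable⁻¹ n>0 playable))) , centre-selected _ _
    alice ea eb (suc i , m , playable)
      with e , f ← select (leaf-playable⁻¹ playable) (alice-leaf m)
      with refl ← trans (sym ea) e
      = leaf , position≅starGame _ (rs _) refl (trans (sym (f λ ())) eb)

    alice⁻¹ : ∀ {a b} → rem A S ≡ a → rem B S ≡ b → (k : StarMove a b) →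
      ∃[ m ] after {Alice} m ≅ leftOption a b k
    alice⁻¹ ea eb (centre p) =
      (zero , alice-C , centre-playable (proj₂ (found ea eb p))) , centre-selected _ _
    alice⁻¹ ea eb leaf
      with i , i∉S , eq ← remaining-find A leaves S (subst (0 <_) (sym ea) 0<1+n)
      with e , f ← select i∉S eq
      = (suc i , subst (MaySelect Alice) (sym eq) alice-A , leaf-playable i∉S)
      , position≅starGame _ (rs _) (suc-injective (trans (sym e) ea)) (trans (sym (f λ ())) eb)

    bob : ∀ {a b} → rem A S ≡ a → rem B S ≡ b → (m : Moves Bob) → ∃[ k ] after m ≅ rightOption a b k
    bob ea eb (zero , _ , playable) =
      -- Bob's moves list his own count first, hence `swap`.
      centre (swap (unfinished ea eb (proj₂ (centre-playable⁻¹ n>0 playable)))) , centre-selected _ _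
    bob ea eb (suc i , m , playable)
      with e , f ← select (leaf-playable⁻¹ playable) (bob-leaf m)
      with refl ← trans (sym eb) e
      = leaf , position≅starGame _ (rs _) (trans (sym (f λ ())) ea) refl

    bob⁻¹ : ∀ {a b} → rem A S ≡ a → rem B S ≡ b → (k : StarMove b a) →
      ∃[ m ] after {Bob} m ≅ rightOption a b k
    bob⁻¹ ea eb (centre p) =
      (zero , bob-C , centre-playable (proj₂ (found ea eb (swap p)))) , centre-selected _ _
    bob⁻¹ ea eb leaf
      with i , i∉S , eq ← remaining-find B leaves S (subst (0 <_) (sym eb) 0<1+n)
      with e , f ← select i∉S eq
      = (suc i , subst (MaySelect Bob) (sym eq) bob-B , leaf-playable i∉S)
      , position≅starGame _ (rs _) (trans (sym (f λ ())) ea) (suc-injective (trans (sym e) eb))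

-- Arithmetic of the surplus and the final cases.

∣-∣≡1 : ∀ a b → ∣ a - b ∣ ≡ 1 → a ≡ suc b ⊎ b ≡ suc a
∣-∣≡1 zero          (suc zero) _ = inj₂ refl
∣-∣≡1 (suc zero)    zero       _ = inj₁ refl
∣-∣≡1 (suc a)       (suc b)    e with ∣-∣≡1 a b e
... | inj₁ refl = inj₁ refl
... | inj₂ refl = inj₂ refl

-- Puts the exponent into the form asked for by `starGame≈↑*`; under this bound the truncated
-- subtractions are exact.
≥+2⇒≡ : ∀ {a b} → a ≥ b + 2 → a ≡ suc ((a ∸ b ∸ 1) + b)
≥+2⇒≡ {suc zero}    {zero}  (s≤s ())
≥+2⇒≡ {suc (suc a)} {zero}  _       = cong suc (sym (+-identityʳ (suc a)))
≥+2⇒≡ {suc a}       {suc b} (s≤s p) =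
  cong suc (trans (≥+2⇒≡ p) (sym (+-suc (a ∸ b ∸ 1) b)))

theorem7 : (n : ℕ) → n ≥ 1 → (leaves : Vec Colour n) (a b : ℕ) →
    #[ A ] leaves ≡ a → #[ B ] leaves ≡ b → a + b ≡ n →
    let value = dominationGame (star n) (lookup (C ∷ leaves)) in
    (a ≡ b → value ≈ *2) ×
    (∣ a - b ∣ ≡ 1 → value ≈ *) ×
    (a ≥ b + 2 → value ≈ ↑^[ a ∸ b ∸ 1 ] ⊕ *) ×
    (b ≥ a + 2 → value ≈ ↓₍ b ∸ a ∸ 1 ₎ ⊕ *)
theorem7 n n≥1 leaves a b refl refl a+b≡n =
    (λ e → from (equal-leaves a+b≡n e))
  , (λ e → from (off-by-one (∣-∣≡1 a b e)))
  , (λ p → from (starGame≈↑* (a ∸ b ∸ 1) (≥+2⇒≡ p)))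
  , (λ p → from (starGame≈↓* (b ∸ a ∸ 1) (≥+2⇒≡ p)))
  where
  value : Game
  value = dominationGame (star n) (lookup (C ∷ leaves))

  value≅ : value ≅ starGame a b
  value≅ = position≅starGame n≥1 leaves (uncoloured-C leaves a+b≡n) ∅ (⊃-wellFounded ∅)
    (remaining-∅ A leaves) (remaining-∅ B leaves)

  from : ∀ {G} → starGame a b ≈ G → value ≈ G
  from = ≈-resp-≅ (≅-sym value≅) ≅-refl

  equal-leaves : ∀ {x y} → x + y ≡ n → x ≡ y → starGame x y ≈ *2
  -- Two zero counts would mean a star without leaves, which `n ≥ 1` excludes.
  equal-leaves {zero}  e    refl = ⊥-elim (n≮0 (subst (0 <_) (sym e) n≥1))
  equal-leaves {suc x} _    refl = starGame≈*2 x

  off-by-one : ∀ {x y} → x ≡ suc y ⊎ y ≡ suc x → starGame x y ≈ *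
  off-by-one {y = y} (inj₁ refl) = starGame≈*ˡ y
  off-by-one {x}     (inj₂ refl) = starGame≈*ʳ x
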